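{- Let $\Sigma$ be a finite alphabet, $\lambda\in[0,1)$, and let $L=\mathcal{L}^{>\lambda}(\mathcal{A}|\mathrm{ND})$ for some quantum automaton $\mathcal{A}$ over $\Sigma$. Then: (1) For any $w\in\Sigma^+$, $u\in\Sigma^*$ and $v\in\Sigma^\omega$, if $uv\in L$ then there are infinitely many positive integers $k$ such that $uw^kv\in L$. (2) For any $v\in L$, there are infinitely many finite prefixes $v_n$ of $v$ such that $v_nw^\omega\in L$ for all $w\in\Sigma^+$.
   Context: A quantum automaton is a tuple $\mathcal{A}=(\mathcal{H},|s_0\rangle,\Sigma,\{U_\sigma:\sigma\in\Sigma\},F)$ where $\mathcal{H}$ is a finite-dimensional complex Hilbert space, $|s_0\rangle$ a unit vector, $\Sigma$ a finite alphabet, each $U_\sigma$ unitary on $\mathcal{H}$, and $F$ a subspace of $\mathcal{H}$. For a finite word $x=\sigma_1\cdots\sigma_m$, $U_x=U_{\sigma_m}\cdots U_{\sigma_1}$. For $w\in\Sigma^\omega$ with prefixes $w_n$ of length $n$, the non-disturbing run is $|s_n\rangle=U_{w_n}|s_0\rangle$ and $$f^{\mathrm{ND}}_{\mathcal{A}}(w)=\sup_{|\psi\rangle\in F,\ \||\psi\rangle\|=1}\sup_{\{n_i\}}\inf_{i\ge1}|\langle\psi|s_{n_i}\rangle|^2,$$ over strictly increasing sequences $0\le n_1<n_2<\cdots$. $\mathcal{L}^{>\lambda}(\mathcal{A}|\mathrm{ND})=\{w\in\Sigma^\omega: f^{\mathrm{ND}}_{\mathcal{A}}(w)>\lambda\}$.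 $w^\omega$ denotes the infinite repetition of $w$. -}

module Defs where

open import Algebra.Bundles using (CommutativeRing; AbelianGroup)
import Algebra.Construct.DirectProduct as DirectProduct
open import Algebra.Definitions.RawMonoid using (sum)
open import Algebra.Module.Bundles using (LeftModule)
open import Algebra.Module.Morphism.Structures using (module LeftModuleMorphisms)
import Algebra.Properties.Ring as RingProperties
import Algebra.Solver.Ring.NaturalCoefficients.Default as NatSolver
open import Axiom.ExcludedMiddle using (ExcludedMiddle)
open import Data.Fin.Base using (Fin)
open import Data.List.Base as List using (List; []; _∷_; foldl; concat; replicate; applyUpTo)
open import Data.List.NonEmpty.Base as List⁺ using (List⁺; toList)
open import Data.Nat.Base as ℕ using (ℕ; zero; suc)
open import Data.Nat.DivMod using (_mod_)
open import Data.Product.Base using (Σ; ∃; _×_; _,_; proj₁; proj₂)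
open import Function.Bundles using (_↔_)
open import Level using (0ℓ)
open import Relation.Binary.Core using (Rel; _Preserves_⟶_)
open import Relation.Binary.Structures using (IsStrictTotalOrder)
open import Relation.Nullary using (¬_; Dec; yes; no)
open import Relation.Unary using (Pred; _∈_)

IsFinite : Set → Set
IsFinite A = ∃ λ k → A ↔ Fin k

InfinitelyMany : Pred ℕ 0ℓ → Set
InfinitelyMany P = ∀ N → ∃ λ n → N ℕ.< n × P n

ωWord : Set → Set
ωWord A = ℕ → A

module _ {A : Set} where

  infixr 5 _⌢_
  infix 8 _^ʷ_ _^ω

  _⌢_ : List A → ωWord A → ωWord A
  ([]      ⌢ v) n       = v n
  ((a ∷ u) ⌢ v) zero    = a
  ((a ∷ u) ⌢ v) (suc n) = (u ⌢ v) n

  _^ʷ_ : List⁺ A → ℕ → List A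
  w ^ʷ k = concat (replicate k (toList w))

  _^ω : List⁺ A → ωWord A
  (w ^ω) n = List.lookup (toList w) (n mod List⁺.length w)

  prefix : ωWord A → ℕ → List A
  prefix = applyUpTo

-- The real numbers, given by the axioms that determine them up to unique
-- isomorphism.
record CompleteOrderedField : Set₁ where
  field
    commutativeRing : CommutativeRing 0ℓ 0ℓ

  open CommutativeRing commutativeRing public

  infix 4 _<_ _≤_

  field
    _<_                : Rel Carrier 0ℓ
    isStrictTotalOrder : IsStrictTotalOrder _≈_ _<_
    0<1                : 0# < 1#
    inverse            : ∀ x → x ≉ 0# → ∃ λ y → x * y ≈ 1#
    +-monoˡ-<          : ∀ z {x y} → x < y → x + z < y + z
    *-pos              : ∀ {x y} → 0# < x → 0# < y → 0# < x * y

  _≤_ : Rel Carrier 0ℓ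
  x ≤ y = ¬ (y < x)

  UpperBound : Pred Carrier 0ℓ → Pred Carrier 0ℓ
  UpperBound S b = ∀ x → x ∈ S → x ≤ b

  IsLeastUpperBound : Pred Carrier 0ℓ → Pred Carrier 0ℓ
  IsLeastUpperBound S b = UpperBound S b × (∀ c → UpperBound S c → b ≤ c)

  field
    complete : (S : Pred Carrier 0ℓ) → ∃ S → ∃ (UpperBound S) → ∃ (IsLeastUpperBound S)

module Quantum (lem : ExcludedMiddle 0ℓ) (reals : CompleteOrderedField) where

  open CompleteOrderedField reals public
    using (_≈_; _<_; _≤_; _+_; _*_; -_; _-_; 0#; 1#)
    renaming (Carrier to ℝ)
  private module R = CompleteOrderedField reals

  Range : {I : Set} → (I → ℝ) → Pred ℝ 0ℓ
  Range g r = ∃ λ i → r ≈ g i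

  -- The value is the supremum only if the family is inhabited and bounded
  -- above, and 0 otherwise.  The families below all lie in [0,1], so the
  -- default is used only for the empty family, whose supremum in [0,1] is 0.
  ⨆ : {I : Set} → (I → ℝ) → ℝ
  ⨆ g with lem {P = ∃ (Range g) × ∃ (R.UpperBound (Range g))}
  ... | yes (inhabited , bounded) = proj₁ (R.complete (Range g) inhabited bounded)
  ... | no  _                     = 0#

  ⨅ : {I : Set} → (I → ℝ) → ℝ
  ⨅ g = - ⨆ (λ i → - g i)

  ℂ : Set
  ℂ = ℝ × ℝ

  re im : ℂ → ℝ
  re = proj₁
  im = proj₂

  infixl 7 _*ᶜ_
  _*ᶜ_ : ℂ → ℂ → ℂ
  (a , b) *ᶜ (c , d) = a * c - b * d , a * d + b * c

  conj : ℂ → ℂ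
  conj (a , b) = a , - b

  ∣_∣² : ℂ → ℝ
  ∣ a , b ∣² = a * a + b * b

  private
    ℝ²-group : AbelianGroup 0ℓ 0ℓ
    ℝ²-group = DirectProduct.abelianGroup R.+-abelianGroup R.+-abelianGroup

    module G = AbelianGroup ℝ²-group

    -- The semiring solver cannot treat negation, so the ring laws are first
    -- proved for the product with i² = j, where j is arbitrary.
    module TwistedProduct (j : ℝ) where
      open NatSolver R.commutativeSemiring

      infixl 7 _⊛_
      _⊛_ : ℂ → ℂ → ℂ
      (a , b) ⊛ (c , d) = a * c + j * (b * d) , a * d + b * c

      ⊛-cong : ∀ {x x′ y y′} → x G.≈ x′ → y G.≈ y′ → (x ⊛ y) G.≈ (x′ ⊛ y′)
      ⊛-cong (p , q) (r , s) =
        R.+-cong (R.*-cong p r) (R.*-congˡ (R.*-cong q s)) , R.+-cong (R.*-cong p s) (R.*-cong q r)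

      ⊛-assoc : ∀ x y z → ((x ⊛ y) ⊛ z) G.≈ (x ⊛ (y ⊛ z))
      ⊛-assoc (a , b) (c , d) (e , f) =
        solve 7 (λ j a b c d e f →
          (a :* c :+ j :* (b :* d)) :* e :+ j :* ((a :* d :+ b :* c) :* f) :=
          a :* (c :* e :+ j :* (d :* f)) :+ j :* (b :* (c :* f :+ d :* e))) R.refl j a b c d e f ,
        solve 7 (λ j a b c d e f →
          (a :* c :+ j :* (b :* d)) :* f :+ (a :* d :+ b :* c) :* e :=
          a :* (c :* f :+ d :* e) :+ b :* (c :* e :+ j :* (d :* f))) R.refl j a b c d e f

      ⊛-comm : ∀ x y → (x ⊛ y) G.≈ (y ⊛ x)
      ⊛-comm (a , b) (c , d) =
        solve 5 (λ j a b c d → a :* c :+ j :* (b :* d) := c :* a :+ j :* (d :* b)) R.refl j a b c d ,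
        solve 4 (λ a b c d → a :* d :+ b :* c := c :* b :+ d :* a) R.refl a b c d

      ⊛-identityˡ : ∀ x → ((1# , 0#) ⊛ x) G.≈ x
      ⊛-identityˡ (a , b) =
        solve 3 (λ j a b → con 1 :* a :+ j :* (con 0 :* b) := a) R.refl j a b ,
        solve 2 (λ a b → con 1 :* b :+ con 0 :* a := b) R.refl a b

      ⊛-distribˡ : ∀ x y z → (x ⊛ (y G.∙ z)) G.≈ ((x ⊛ y) G.∙ (x ⊛ z))
      ⊛-distribˡ (a , b) (c , d) (e , f) =
        solve 7 (λ j a b c d e f →
          a :* (c :+ e) :+ j :* (b :* (d :+ f)) :=
          (a :* c :+ j :* (b :* d)) :+ (a :* e :+ j :* (b :* f))) R.refl j a b c d e f ,
        solve 6 (λ a b c d e f →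
          a :* (d :+ f) :+ b :* (c :+ e) := (a :* d :+ b :* c) :+ (a :* f :+ b :* e)) R.refl a b c d e f

    open TwistedProduct (- 1#)

    *ᶜ≈⊛ : ∀ x y → (x *ᶜ y) G.≈ (x ⊛ y)
    *ᶜ≈⊛ (a , b) (c , d) = R.+-congˡ (R.sym (RingProperties.-1*x≈-x R.ring (b * d))) , R.refl

    *ᶜ-cong : ∀ {x x′ y y′} → x G.≈ x′ → y G.≈ y′ → (x *ᶜ y) G.≈ (x′ *ᶜ y′)
    *ᶜ-cong {x} {x′} {y} {y′} p q = G.trans (*ᶜ≈⊛ x y) (G.trans (⊛-cong p q) (G.sym (*ᶜ≈⊛ x′ y′)))

    *ᶜ-comm : ∀ x y → (x *ᶜ y) G.≈ (y *ᶜ x)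
    *ᶜ-comm x y = G.trans (*ᶜ≈⊛ x y) (G.trans (⊛-comm x y) (G.sym (*ᶜ≈⊛ y x)))

    *ᶜ-assoc : ∀ x y z → ((x *ᶜ y) *ᶜ z) G.≈ (x *ᶜ (y *ᶜ z))
    *ᶜ-assoc x y z =
      G.trans (*ᶜ≈⊛ (x *ᶜ y) z) (G.trans (⊛-cong (*ᶜ≈⊛ x y) G.refl) (G.trans (⊛-assoc x y z)
        (G.sym (G.trans (*ᶜ≈⊛ x (y *ᶜ z)) (⊛-cong G.refl (*ᶜ≈⊛ y z))))))

    *ᶜ-identityˡ : ∀ x → ((1# , 0#) *ᶜ x) G.≈ x
    *ᶜ-identityˡ x = G.trans (*ᶜ≈⊛ (1# , 0#) x) (⊛-identityˡ x)

    *ᶜ-distribˡ : ∀ x y z → (x *ᶜ (y G.∙ z)) G.≈ ((x *ᶜ y) G.∙ (x *ᶜ z))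
    *ᶜ-distribˡ x y z =
      G.trans (*ᶜ≈⊛ x (y G.∙ z)) (G.trans (⊛-distribˡ x y z)
        (G.sym (G.∙-cong (*ᶜ≈⊛ x y) (*ᶜ≈⊛ x z))))

  ℂ-commutativeRing : CommutativeRing 0ℓ 0ℓ
  ℂ-commutativeRing = record
    { Carrier = ℂ
    ; _≈_ = G._≈_
    ; _+_ = G._∙_
    ; _*_ = _*ᶜ_
    ; -_  = G._⁻¹
    ; 0#  = 0# , 0#
    ; 1#  = 1# , 0#
    ; isCommutativeRing = record
      { isRing = record
        { +-isAbelianGroup = G.isAbelianGroup
        ; *-cong     = *ᶜ-cong
        ; *-assoc    = *ᶜ-assoc
        ; *-identity = *ᶜ-identityˡ , λ x → G.trans (*ᶜ-comm x (1# , 0#)) (*ᶜ-identityˡ x)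
        ; distrib    = *ᶜ-distribˡ , λ x y z → G.trans (*ᶜ-comm (y G.∙ z) x)
                         (G.trans (*ᶜ-distribˡ x y z) (G.∙-cong (*ᶜ-comm x y) (*ᶜ-comm x z)))
        }
      ; *-comm = *ᶜ-comm
      }
    }

  private module C = CommutativeRing ℂ-commutativeRing

  -- No completeness axiom: finite-dimensional complex inner product spaces
  -- are complete.
  record FiniteDimensionalHilbertSpace : Set₁ where
    field
      vectorSpace : LeftModule C.ring 0ℓ 0ℓ

    open LeftModule vectorSpace public

    field
      ⟨_∣_⟩         : Carrierᴹ → Carrierᴹ → ℂ
      ⟨∣⟩-cong      : ∀ {x x′ y y′} → x ≈ᴹ x′ → y ≈ᴹ y′ → ⟨ x ∣ y ⟩ C.≈ ⟨ x′ ∣ y′ ⟩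
      ⟨∣⟩-conj      : ∀ x y → ⟨ x ∣ y ⟩ C.≈ conj ⟨ y ∣ x ⟩
      ⟨∣⟩-+         : ∀ x y z → ⟨ x ∣ y +ᴹ z ⟩ C.≈ ⟨ x ∣ y ⟩ C.+ ⟨ x ∣ z ⟩
      ⟨∣⟩-*         : ∀ c x y → ⟨ x ∣ c *ₗ y ⟩ C.≈ c C.* ⟨ x ∣ y ⟩
      ⟨∣⟩-nonneg    : ∀ x → 0# ≤ re ⟨ x ∣ x ⟩
      ⟨∣⟩-definite  : ∀ x → ⟨ x ∣ x ⟩ C.≈ C.0# → x ≈ᴹ 0ᴹ

      finiteDimensional : ∃ λ d → Σ (Fin d → Carrierᴹ) λ e →
        ∀ x → Σ (Fin d → ℂ) λ c → x ≈ᴹ sum +ᴹ-rawMonoid (λ i → c i *ₗ e i)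

    IsUnit : Pred Carrierᴹ 0ℓ
    IsUnit x = ⟨ x ∣ x ⟩ C.≈ C.1#

    open LeftModuleMorphisms rawLeftModule rawLeftModule using (IsLeftModuleHomomorphism)

    record Unitary : Set where
      field
        op       : Carrierᴹ → Carrierᴹ
        isLinear : IsLeftModuleHomomorphism op
        adj      : Carrierᴹ → Carrierᴹ
        adjoint  : ∀ x y → ⟨ op x ∣ y ⟩ C.≈ ⟨ x ∣ adj y ⟩
        adj-op   : ∀ x → adj (op x) ≈ᴹ x
        op-adj   : ∀ x → op (adj x) ≈ᴹ x

    record Subspace : Set₁ where
      field
        member   : Pred Carrierᴹ 0ℓ
        resp     : ∀ {x y} → x ≈ᴹ y → x ∈ member → y ∈ member
        0-closed : 0ᴹ ∈ member
        +-closed : ∀ {x y} → x ∈ member → y ∈ member → x +ᴹ y ∈ member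
        *-closed : ∀ c {x} → x ∈ member → c *ₗ x ∈ member

  record QuantumAutomaton (A : Set) : Set₁ where
    field
      space : FiniteDimensionalHilbertSpace

    open FiniteDimensionalHilbertSpace space public

    field
      s₀        : Carrierᴹ
      s₀-isUnit : IsUnit s₀
      U         : A → Unitary
      F         : Subspace

    U* : List A → Carrierᴹ → Carrierᴹ
    U* x s = foldl (λ t σ → Unitary.op (U σ) t) s x

    run : ωWord A → ℕ → Carrierᴹ
    run w n = U* (prefix w n) s₀

    UnitVectorOfF : Set
    UnitVectorOfF = Σ Carrierᴹ λ ψ → ψ ∈ Subspace.member F × IsUnit ψ

  StrictlyIncreasing : Set
  StrictlyIncreasing = Σ (ℕ → ℕ) λ n → n Preserves ℕ._<_ ⟶ ℕ._<_

  fᴺᴰ : {A : Set} → QuantumAutomaton A → ωWord A → ℝ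
  fᴺᴰ 𝒜 w = ⨆ {UnitVectorOfF} λ (ψ , _) → ⨆ {StrictlyIncreasing} λ (n , _) →
              ⨅ {ℕ} λ i → ∣ ⟨ ψ ∣ run w (n i) ⟩ ∣²
    where open QuantumAutomaton 𝒜

  𝓛ᴺᴰ> : {A : Set} → ℝ → QuantumAutomaton A → Pred (ωWord A) 0ℓ
  𝓛ᴺᴰ> θ 𝒜 w = θ < fᴺᴰ 𝒜 w

{-# OPTIONS --safe #-}

-- A word w acts by an isometry of a finite-dimensional space, so by
-- compactness every state s is recurrent: U_w^k s is arbitrarily close to s
-- for infinitely many k.  A word v lies in L iff some unit ψ ∈ F and some
-- δ > λ satisfy |⟨ψ|s_n⟩|² ≥ δ for infinitely many n, and these inequalities
-- survive a small perturbation of the states up to a slightly smaller δ > λ.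
-- For (1), inserting w^k with U_w^k U_u s₀ close to U_u s₀ moves all later
-- states by the same small distance.  For (2), any n with |⟨ψ|s_n⟩|² ≥ δ will
-- do, since w^ω brings s_n back close to itself infinitely often.
--
-- Compactness is proved for the real form re⟨x|y⟩ by induction on a spanning
-- list: pass to a subsequence on which the coefficient along the first vector
-- e is nearly constant, and replace the form by its Schur complement at e.
module Submission where

open import Defs
open import Algebra.Bundles using (CommutativeRing)
open import Algebra.Definitions.RawMonoid using (sum)
import Algebra.Properties.AbelianGroup as AbelianGroupProperties
import Algebra.Properties.CommutativeSemigroup as CommutativeSemigroupProperties
import Algebra.Properties.Ring as RingProperties
import Algebra.Properties.Semiring.Mult.TCOptimised as Mult
import Algebra.Solver.Ring as RingSolver
open import Algebra.Solver.Ring.AlmostCommutativeRing using (fromCommutativeRing; _-Raw-AlmostCommutative⟶_)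
open import Axiom.ExcludedMiddle using (ExcludedMiddle)
open import Data.Empty using (⊥-elim)
open import Data.Fin.Base as Fin using (Fin; toℕ)
import Data.Fin.Properties as Fin
open import Data.Integer.Base as ℤ using (ℤ; +_; -[1+_]; +[1+_])
import Data.Integer.Properties as ℤ
open import Data.List.Base using (List; []; _∷_; _++_; length; tabulate; lookup)
open import Data.List.NonEmpty.Base as List⁺ using (List⁺; toList)
import Data.List.Properties as List
open import Data.List.Relation.Unary.All as All using (All; []; _∷_)
import Data.List.Relation.Unary.All.Properties as All
open import Data.Maybe.Base as Maybe using ()
open import Data.Nat.Base as ℕ using (ℕ; zero; suc)
open import Data.Nat.DivMod using (_mod_; _%_; m%n<n; m<n⇒m%n≡m; [m+n]%n≡m%n)
import Data.Nat.Properties as ℕ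
open import Data.Product.Base using (Σ; ∃; _×_; _,_; proj₁; proj₂)
open import Data.Sum.Base using (_⊎_; inj₁; inj₂)
open import Level using (0ℓ)
open import Relation.Binary.Core using (_Preserves_⟶_)
open import Relation.Binary.Definitions using (tri<; tri≈; tri>)
open import Relation.Binary.PropositionalEquality as ≡ using (_≡_)
open import Relation.Binary.Structures using (IsStrictTotalOrder)
open import Relation.Nullary using (¬_; yes; no)
open import Relation.Nullary.Decidable using (dec⇒maybe; decidable-stable)
open import Relation.Unary using (Pred; _∈_; _≐_)

-- Normalisation of polynomial identities with integer coefficients.

-- The library's solver over an arbitrary ring needs coefficients with an
-- equality test that computes, or else it cannot cancel x - x.
module IntegerCoefficientSolver {c ℓ} (R : CommutativeRing c ℓ) where
  open CommutativeRing R
  open import Relation.Binary.Reasoning.Setoid setoid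
  open Mult semiring using (1+×; ×-homo-+; ×1-homo-*) renaming (_×_ to _×′_)
  open AbelianGroupProperties +-abelianGroup using ()
    renaming (⁻¹-∙-comm to -‿+-comm; ⁻¹-involutive to -‿involutive; ε⁻¹≈ε to -0≈0)
  open CommutativeSemigroupProperties +-commutativeSemigroup using (interchange)
  open RingProperties ring using (-‿distribˡ-*; -‿distribʳ-*)

  -- With this form of multiple, `ι 1` computes to `1#`, so `1-homo` is `refl` and `con (+ 1)`
  -- denotes `1#` itself.
  ι : ℕ → Carrier
  ι n = n ×′ 1#

  fromℤ : ℤ → Carrier
  fromℤ (+ n)    = ι n
  fromℤ -[1+ n ] = - ι (suc n)

  fromℤ-⊖ : ∀ m n → fromℤ (m ℤ.⊖ n) ≈ ι m - ι n
  fromℤ-⊖ m       zero    = sym (trans (+-congˡ -0≈0) (+-identityʳ (ι m)))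
  fromℤ-⊖ zero    (suc n) = sym (+-identityˡ (- ι (suc n)))
  fromℤ-⊖ (suc m) (suc n) = begin
    fromℤ (suc m ℤ.⊖ suc n)     ≡⟨ ≡.cong fromℤ (ℤ.[1+m]⊖[1+n]≡m⊖n m n) ⟩
    fromℤ (m ℤ.⊖ n)             ≈⟨ fromℤ-⊖ m n ⟩
    ι m - ι n                   ≈⟨ +-identityˡ _ ⟨
    0# + (ι m - ι n)            ≈⟨ +-congʳ (-‿inverseʳ 1#) ⟨
    (1# - 1#) + (ι m - ι n)     ≈⟨ interchange 1# (- 1#) (ι m) (- ι n) ⟩
    (1# + ι m) + (- 1# - ι n)   ≈⟨ +-cong (sym (1+× m 1#)) (trans (-‿+-comm 1# (ι n)) (-‿cong (sym (1+× n 1#)))) ⟩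
    ι (suc m) - ι (suc n)       ∎

  fromℤ-+ : ∀ i j → fromℤ (i ℤ.+ j) ≈ fromℤ i + fromℤ j
  fromℤ-+ (+ m)    (+ n)    = ×-homo-+ 1# m n
  fromℤ-+ (+ m)    -[1+ n ] = fromℤ-⊖ m (suc n)
  fromℤ-+ -[1+ m ] (+ n)    = trans (fromℤ-⊖ n (suc m)) (+-comm (ι n) (- ι (suc m)))
  fromℤ-+ -[1+ m ] -[1+ n ] = begin
    - ι (suc (suc (m ℕ.+ n)))   ≡⟨ ≡.cong (λ k → - ι (suc k)) (ℕ.+-suc m n) ⟨
    - ι (suc m ℕ.+ suc n)       ≈⟨ -‿cong (×-homo-+ 1# (suc m) (suc n)) ⟩
    - (ι (suc m) + ι (suc n))   ≈⟨ -‿+-comm (ι (suc m)) (ι (suc n)) ⟨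
    - ι (suc m) - ι (suc n)     ∎

  fromℤ-neg : ∀ i → fromℤ (ℤ.- i) ≈ - fromℤ i
  fromℤ-neg (+ zero) = sym -0≈0
  fromℤ-neg +[1+ n ] = refl
  fromℤ-neg -[1+ n ] = sym (-‿involutive (ι (suc n)))

  fromℤ-negProduct : ∀ m n → fromℤ (ℤ.- (+ (m ℕ.* n))) ≈ - (ι m * ι n)
  fromℤ-negProduct m n = trans (fromℤ-neg (+ (m ℕ.* n))) (-‿cong (×1-homo-* m n))

  fromℤ-* : ∀ i j → fromℤ (i ℤ.* j) ≈ fromℤ i * fromℤ j
  fromℤ-* (+ m)    (+ n)    rewrite ℤ.+◃n≡+n (m ℕ.* n)     = ×1-homo-* m n
  fromℤ-* (+ m)    -[1+ n ] rewrite ℤ.-◃n≡-n (m ℕ.* suc n) =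
    trans (fromℤ-negProduct m (suc n)) (-‿distribʳ-* _ _)
  fromℤ-* -[1+ m ] (+ n)    rewrite ℤ.-◃n≡-n (suc m ℕ.* n) =
    trans (fromℤ-negProduct (suc m) n) (-‿distribˡ-* _ _)
  fromℤ-* -[1+ m ] -[1+ n ] = begin
    ι (suc m ℕ.* suc n)             ≈⟨ ×1-homo-* (suc m) (suc n) ⟩
    ι (suc m) * ι (suc n)           ≈⟨ -‿involutive _ ⟨
    - (- (ι (suc m) * ι (suc n)))   ≈⟨ -‿cong (-‿distribˡ-* _ _) ⟩
    - ((- ι (suc m)) * ι (suc n))   ≈⟨ -‿distribʳ-* _ _ ⟩
    (- ι (suc m)) * (- ι (suc n))   ∎

  fromℤ-morphism : ℤ.+-*-rawRing -Raw-AlmostCommutative⟶ fromCommutativeRing R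
  fromℤ-morphism = record
    { ⟦_⟧    = fromℤ
    ; +-homo = fromℤ-+
    ; *-homo = fromℤ-*
    ; -‿homo = fromℤ-neg
    ; 0-homo = refl
    ; 1-homo = refl
    }

  open RingSolver ℤ.+-*-rawRing (fromCommutativeRing R) fromℤ-morphism
    (λ i j → Maybe.map (λ i≡j → reflexive (≡.cong fromℤ i≡j)) (dec⇒maybe (i ℤ.≟ j)))
    public using (solve; con; _:=_; _:+_; _:*_; _:-_; :-_)

-- Subsequences of the natural numbers.

subsequence : ∀ {P} → InfinitelyMany P →
  Σ (ℕ → ℕ) λ σ → σ Preserves ℕ._<_ ⟶ ℕ._<_ × (∀ i → P (σ i))
subsequence {P} often = σ , increasing , holds
  where
  σ : ℕ → ℕ
  σ zero    = proj₁ (often 0)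
  σ (suc i) = proj₁ (often (σ i))

  holds : ∀ i → P (σ i)
  holds zero    = proj₂ (proj₂ (often 0))
  holds (suc i) = proj₂ (proj₂ (often (σ i)))

  increasing : σ Preserves ℕ._<_ ⟶ ℕ._<_
  increasing {i} {suc j} (ℕ.s≤s i≤j) with ℕ.m≤n⇒m<n∨m≡n i≤j
  ... | inj₁ i<j    = ℕ.<-trans (increasing i<j) (proj₁ (proj₂ (often (σ j))))
  ... | inj₂ ≡.refl = proj₁ (proj₂ (often (σ j)))

increasing⇒≥ : ∀ {σ} → σ Preserves ℕ._<_ ⟶ ℕ._<_ → ∀ i → i ℕ.≤ σ i
increasing⇒≥ mono zero    = ℕ.z≤n
increasing⇒≥ mono (suc i) = ℕ.≤-<-trans (increasing⇒≥ mono i) (mono (ℕ.n<1+n i))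

-- Inequalities in the real field.

module OrderedField (reals : CompleteOrderedField) where
  open CompleteOrderedField reals
  open IntegerCoefficientSolver commutativeRing
  private module O = IsStrictTotalOrder isStrictTotalOrder

  abstract
    ≤-reflexive : ∀ {x y} → x ≈ y → x ≤ y
    ≤-reflexive x≈y y<x = O.irrefl (sym x≈y) y<x

    <⇒≤ : ∀ {x y} → x < y → x ≤ y
    <⇒≤ = O.asym

    ≤⇒<⊎≈ : ∀ {x y} → x ≤ y → x < y ⊎ x ≈ y
    ≤⇒<⊎≈ {x} {y} x≤y with O.compare x y
    ... | tri< x<y _ _ = inj₁ x<y
    ... | tri≈ _ x≈y _ = inj₂ x≈y
    ... | tri> _ _ y<x = ⊥-elim (x≤y y<x)

    <-≤-trans : ∀ {x y z} → x < y → y ≤ z → x < z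
    <-≤-trans x<y y≤z with ≤⇒<⊎≈ y≤z
    ... | inj₁ y<z = O.trans x<y y<z
    ... | inj₂ y≈z = O.<-respʳ-≈ y≈z x<y

    ≤-<-trans : ∀ {x y z} → x ≤ y → y < z → x < z
    ≤-<-trans x≤y y<z with ≤⇒<⊎≈ x≤y
    ... | inj₁ x<y = O.trans x<y y<z
    ... | inj₂ x≈y = O.<-respˡ-≈ (sym x≈y) y<z

    ≤-trans : ∀ {x y z} → x ≤ y → y ≤ z → x ≤ z
    ≤-trans x≤y y≤z z<x = x≤y (≤-<-trans y≤z z<x)

    <⇒0<- : ∀ {x y} → x < y → 0# < y - x
    <⇒0<- {x} x<y = O.<-respˡ-≈ (-‿inverseʳ x) (+-monoˡ-< (- x) x<y)

    0<-⇒< : ∀ {x y e} → 0# < e → e ≈ y - x → x < y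
    0<-⇒< {x} {y} {e} 0<e e≈y-x =
      O.<-respˡ-≈ (+-identityˡ x) (O.<-respʳ-≈ eq (+-monoˡ-< x 0<e))
      where
      eq : e + x ≈ y
      eq = trans (+-congʳ e≈y-x) (solve 2 (λ x y → (y :- x) :+ x := y) refl x y)

    ≤⇒0≤- : ∀ {x y} → x ≤ y → 0# ≤ y - x
    ≤⇒0≤- {x} {y} x≤y y-x<0 = x≤y (0<-⇒< (<⇒0<- y-x<0)
      (solve 2 (λ x y → con (+ 0) :- (y :- x) := x :- y) refl x y))

    0≤-⇒≤ : ∀ {x y e} → 0# ≤ e → e ≈ y - x → x ≤ y
    0≤-⇒≤ {x} {y} {e} 0≤e e≈y-x y<x = 0≤e (0<-⇒< (<⇒0<- y<x)
      (trans (solve 2 (λ x y → x :- y := con (+ 0) :- (y :- x)) refl x y) (+-congˡ (-‿cong (sym e≈y-x)))))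

    0≤-resp : ∀ {x y} → x ≈ y → 0# ≤ x → 0# ≤ y
    0≤-resp x≈y 0≤x y<0 = 0≤x (O.<-respˡ-≈ (sym x≈y) y<0)

    0≤+ : ∀ {x y} → 0# ≤ x → 0# ≤ y → 0# ≤ x + y
    0≤+ {x} {y} 0≤x 0≤y = ≤-trans 0≤x (0≤-⇒≤ 0≤y (solve 2 (λ x y → y := (x :+ y) :- x) refl x y))

    0≤* : ∀ {x y} → 0# ≤ x → 0# ≤ y → 0# ≤ x * y
    0≤* {x} {y} 0≤x 0≤y with ≤⇒<⊎≈ 0≤x | ≤⇒<⊎≈ 0≤y
    ... | inj₁ 0<x | inj₁ 0<y = <⇒≤ (*-pos 0<x 0<y)
    ... | inj₂ 0≈x | _        = ≤-reflexive (trans (sym (zeroˡ y)) (*-congʳ 0≈x))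
    ... | _        | inj₂ 0≈y = ≤-reflexive (trans (sym (zeroʳ x)) (*-congˡ 0≈y))

    0≤x² : ∀ x → 0# ≤ x * x
    0≤x² x with O._<?_ x 0#
    ... | no  0≤x = 0≤* 0≤x 0≤x
    ... | yes x<0 = 0≤-resp (solve 1 (λ x → (con (+ 0) :- x) :* (con (+ 0) :- x) := x :* x) refl x)
                            (0≤* (<⇒≤ (<⇒0<- x<0)) (<⇒≤ (<⇒0<- x<0)))

    0<+ : ∀ {x y} → 0# < x → 0# ≤ y → 0# < x + y
    0<+ {x} {y} 0<x 0≤y = <-≤-trans 0<x (0≤-⇒≤ 0≤y (solve 2 (λ x y → y := (x :+ y) :- x) refl x y))

    x<x+η : ∀ x {η} → 0# < η → x < x + η
    x<x+η x {η} 0<η = 0<-⇒< 0<η (solve 2 (λ x η → η := (x :+ η) :- x) refl x η)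

    x-η<x : ∀ x {η} → 0# < η → x - η < x
    x-η<x x {η} 0<η = 0<-⇒< 0<η (solve 2 (λ x η → η := x :- (x :- η)) refl x η)

    0≤-cancelˡ : ∀ {a x} → 0# < a → 0# ≤ a * x → 0# ≤ x
    0≤-cancelˡ {a} {x} 0<a 0≤ax x<0 = 0≤ax (0<-⇒< (*-pos 0<a (<⇒0<- x<0))
      (solve 2 (λ a x → a :* (con (+ 0) :- x) := con (+ 0) :- a :* x) refl a x))

    positiveInverse : ∀ {x} → 0# < x → ∃ λ y → 0# < y × x * y ≈ 1#
    positiveInverse {x} 0<x with inverse x (λ x≈0 → O.irrefl (sym x≈0) 0<x)
    ... | y , xy≈1 with ≤⇒<⊎≈ (0≤-cancelˡ 0<x (0≤-resp (sym xy≈1) (<⇒≤ 0<1)))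
    ...   | inj₁ 0<y = y , 0<y , xy≈1
    ...   | inj₂ 0≈y = ⊥-elim (O.irrefl (trans (sym (zeroʳ x)) (trans (*-congˡ 0≈y) xy≈1)) 0<1)

    half : ∃ λ h → 0# < h × (1# + 1#) * h ≈ 1#
    half = positiveInverse (0<+ 0<1 (<⇒≤ 0<1))

    ½ : Carrier
    ½ = proj₁ half

    0<½ : 0# < ½
    0<½ = proj₁ (proj₂ half)

    ½+½ : ∀ x → ½ * x + ½ * x ≈ x
    ½+½ x = trans (solve 2 (λ h x → h :* x :+ h :* x := (con (+ 1) :+ con (+ 1)) :* h :* x) refl ½ x)
      (trans (*-congʳ (proj₂ (proj₂ half))) (*-identityˡ x))

    -- Expanding `(x - 1)² ≥ 0` gives `2x ≤ x² + 1 ≤ c + 1`, a bound free of square roots.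
    x²≤c⇒≤ : ∀ {x c} → x * x ≤ c → x ≤ ½ * (c + 1#)
    x²≤c⇒≤ {x} {c} x²≤c = 0≤-⇒≤ (0≤* (<⇒≤ 0<½) (0≤+ (0≤x² (x - 1#)) (≤⇒0≤- x²≤c)))
      (trans (solve 3 (λ h x c → h :* ((x :- con (+ 1)) :* (x :- con (+ 1)) :+ (c :- x :* x))
                              := h :* (c :+ con (+ 1)) :- (h :* x :+ h :* x)) refl ½ x c)
             (+-congˡ (-‿cong (½+½ x))))

    x²≤c⇒≥ : ∀ {x c} → x * x ≤ c → - (½ * (c + 1#)) ≤ x
    x²≤c⇒≥ {x} {c} x²≤c = 0≤-⇒≤
      (≤⇒0≤- (x²≤c⇒≤ {x = - x} (≤-trans (≤-reflexive (solve 1 (λ x → (:- x) :* (:- x) := x :* x) refl x)) x²≤c)))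
      (solve 2 (λ x y → y :- :- x := x :- :- y) refl x (½ * (c + 1#)))

    -- The two regimes γ ≤ 1 and 1 < γ stand in for taking a square root of γ.
    squareBelow : ∀ {γ} → 0# < γ → ∃ λ η → 0# < η × η ≤ 1# × η ≤ γ × η * η ≤ γ
    squareBelow {γ} 0<γ with O._<?_ 1# γ
    ... | yes 1<γ = 1# , 0<1 , ≤-reflexive refl , <⇒≤ 1<γ ,
                    ≤-trans (≤-reflexive (*-identityˡ 1#)) (<⇒≤ 1<γ)
    ... | no  γ≤1 = γ , 0<γ , γ≤1 , ≤-reflexive refl ,
                    0≤-⇒≤ (0≤* (<⇒≤ 0<γ) (≤⇒0≤- γ≤1))
                          (solve 1 (λ γ → γ :* (con (+ 1) :- γ) := γ :- γ :* γ) refl γ)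

    x²≤c²⇐ : ∀ {x c} → x ≤ c → - x ≤ c → x * x ≤ c * c
    x²≤c²⇐ {x} {c} x≤c -x≤c = 0≤-⇒≤ (0≤* (≤⇒0≤- x≤c) (≤⇒0≤- -x≤c))
      (solve 2 (λ x c → (c :- x) :* (c :- :- x) := c :* c :- x :* x) refl x c)

    withinRadius : ∀ {s η x y} → s - ½ * η ≤ x × x ≤ s + ½ * η → s - ½ * η ≤ y × y ≤ s + ½ * η →
      (x - y) * (x - y) ≤ η * η
    withinRadius {s} {η} {x} {y} x-near y-near = x²≤c²⇐ (diff x-near y-near)
      (≤-trans (≤-reflexive (solve 2 (λ x y → :- (x :- y) := y :- x) refl x y)) (diff y-near x-near))
      where
      diff : ∀ {x y} → s - ½ * η ≤ x × x ≤ s + ½ * η → s - ½ * η ≤ y × y ≤ s + ½ * η → x - y ≤ η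
      diff {x} {y} (_ , x≤) (≤y , _) = 0≤-⇒≤ (0≤+ (≤⇒0≤- x≤) (≤⇒0≤- ≤y))
        (trans (solve 4 (λ s t x y → ((s :+ t) :- x) :+ (y :- (s :- t)) := (t :+ t) :- (x :- y)) refl
                  s (½ * η) x y)
               (+-congʳ (½+½ η)))

-- Limit superior and clustering of bounded real sequences.

module BoundedSequences (lem : ExcludedMiddle 0ℓ) (reals : CompleteOrderedField) where
  open CompleteOrderedField reals
  open OrderedField reals

  abstract
    ¬¬-elim : {P : Set} → ¬ ¬ P → P
    ¬¬-elim = decidable-stable lem

    ¬InfinitelyMany : ∀ {P : Pred ℕ 0ℓ} → ¬ InfinitelyMany P → ∃ λ N → ∀ n → N ℕ.< n → ¬ P n
    ¬InfinitelyMany ¬often = ¬¬-elim λ ¬bound → ¬often λ N → ¬¬-elim λ ¬later →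
      ¬bound (N , λ n N<n Pn → ¬later (n , N<n , Pn))

    often-between : ∀ (f : ℕ → Carrier) {a b} → InfinitelyMany (λ n → a ≤ f n) → ¬ InfinitelyMany (λ n → b ≤ f n) →
      InfinitelyMany (λ n → a ≤ f n × f n ≤ b)
    often-between f often-above not-often-above N with ¬InfinitelyMany not-often-above
    ... | M , below with often-above (N ℕ.⊔ M)
    ...   | n , N⊔M<n , a≤fn = n , ℕ.m⊔n<o⇒m<o N M N⊔M<n , a≤fn ,
                               λ b<fn → below n (ℕ.m⊔n<o⇒n<o N M N⊔M<n) (<⇒≤ b<fn)

    limitSuperior : ∀ (f : ℕ → Carrier) {a b} → (∀ n → a ≤ f n) → (∀ n → f n ≤ b) →
      ∃ (IsLeastUpperBound (λ r → InfinitelyMany (λ n → r ≤ f n)))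
    limitSuperior f {a} {b} a≤f f≤b = complete (λ r → InfinitelyMany (λ n → r ≤ f n))
      (a , λ N → suc N , ℕ.n<1+n N , a≤f (suc N))
      (b , λ r often → let n , _ , r≤fn = often 0 in ≤-trans r≤fn (f≤b n))

    -- The set of levels reached infinitely often is downward closed. Hence `s - η` belongs to it,
    -- as otherwise it would be an upper bound below `s`, while `s + η` lies above every member.
    often-near-limitSuperior : ∀ (f : ℕ → Carrier) {s} →
        IsLeastUpperBound (λ r → InfinitelyMany (λ n → r ≤ f n)) s →
      ∀ η → 0# < η → InfinitelyMany (λ n → s - η ≤ f n × f n ≤ s + η)
    often-near-limitSuperior f {s} (upper , least) η 0<η = often-between f
      (¬¬-elim λ ¬often → least (s - η)
        (λ r often s-η<r → ¬often λ N → let n , N<n , r≤fn = often N in n , N<n , ≤-trans (<⇒≤ s-η<r) r≤fn)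
        (x-η<x s 0<η))
      (λ often → upper (s + η) often (x<x+η s 0<η))

    -- Keep the indices at which `f` is within `½ * η` of its limit superior, where `η * η ≤ γ`; any
    -- two such values differ by at most `η`.
    clusteredSubsequence : ∀ (f : ℕ → Carrier) {C} → (∀ n → f n * f n ≤ C) → ∀ {γ} → 0# < γ →
      Σ (ℕ → ℕ) λ σ → σ Preserves ℕ._<_ ⟶ ℕ._<_ ×
        (∀ i j → (f (σ i) - f (σ j)) * (f (σ i) - f (σ j)) ≤ γ)
    clusteredSubsequence f f²≤C 0<γ
      with squareBelow 0<γ | limitSuperior f (λ n → x²≤c⇒≥ (f²≤C n)) (λ n → x²≤c⇒≤ (f²≤C n))
    ... | η , 0<η , _ , _ , η²≤γ | s , isLimit
      with subsequence {λ n → s - ½ * η ≤ f n × f n ≤ s + ½ * η}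
             (often-near-limitSuperior f isLimit (½ * η) (*-pos 0<½ 0<η))
    ...   | σ , mono , near = σ , mono , λ i j → ≤-trans (withinRadius (near i) (near j)) η²≤γ

-- Positive semidefinite forms, compactness and recurrence.

-- V is a real vector space of which only the operation x + t z is needed.
module PositiveForms (lem : ExcludedMiddle 0ℓ) (reals : CompleteOrderedField)
  (V : Set) (_⊞_·_ : V → CompleteOrderedField.Carrier reals → V → V) where
  open CompleteOrderedField reals
  open IntegerCoefficientSolver commutativeRing
  open OrderedField reals
  open BoundedSequences lem reals

  record PositiveForm : Set where
    field
      form      : V → V → Carrier
      symmetric : ∀ x y → form x y ≈ form y x
      linear    : ∀ x y t z → form x (y ⊞ t · z) ≈ form x y + t * form x z
      nonneg    : ∀ x → 0# ≤ form x x

    dist² : V → V → Carrier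
    dist² x y = form (x ⊞ (- 1#) · y) (x ⊞ (- 1#) · y)

    abstract
      expand : ∀ x t z → form (x ⊞ t · z) (x ⊞ t · z) ≈ form x x + (t + t) * form x z + t * t * form z z
      expand x t z = trans (linear _ x t z) (trans
        (+-cong (trans (symmetric _ x) (linear x x t z))
                (*-congˡ (trans (symmetric _ z) (trans (linear z x t z) (+-congʳ (symmetric z x))))))
        (solve 4 (λ a b c t → (a :+ t :* b) :+ t :* (b :+ t :* c) := a :+ (t :+ t) :* b :+ t :* t :* c) refl
          (form x x) (form x z) (form z z) t))

      -- A distance depends only on three Gram entries, so anything preserving `form` preserves
      -- `dist²`, with no equality on `V` involved.
      dist²-cong : ∀ {x y x′ y′} → form x x ≈ form x′ x′ → form x y ≈ form x′ y′ → form y y ≈ form y′ y′ →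
        dist² x y ≈ dist² x′ y′
      dist²-cong xx xy yy = trans (expand _ _ _) (trans
        (+-cong (+-cong xx (*-congˡ xy)) (*-congˡ yy)) (sym (expand _ _ _)))

      -- If p = form e x were nonzero, form would be negative at
      -- x - ((form x x + 1) / p) e.
      nullVector : ∀ {e} → form e e ≈ 0# → ∀ x → form e x ≈ 0#
      nullVector {e} ee≈0 x = ¬¬-elim λ p≉0 → negative (inverse p p≉0)
        where
        a p : Carrier
        a = form x x
        p = form e x

        value : ∀ q → p * q ≈ 1# → form (x ⊞ (- ((a + 1#) * q)) · e) (x ⊞ (- ((a + 1#) * q)) · e)
                                    ≈ 0# - ((1# + 1#) + a)
        value q pq≈1 = trans (expand x _ e) (trans
          (+-cong (+-congˡ (*-congˡ (symmetric x e))) (*-congˡ ee≈0)) (trans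
          (solve 3 (λ a p q → let t = :- ((a :+ con (+ 1)) :* q) in
              a :+ (t :+ t) :* p :+ t :* t :* con (+ 0)
              := a :- ((a :+ con (+ 1)) :* (p :* q) :+ (a :+ con (+ 1)) :* (p :* q))) refl a p q) (trans
          (+-congˡ (-‿cong (+-cong (*-congˡ pq≈1) (*-congˡ pq≈1))))
          (solve 1 (λ a → let c = (a :+ con (+ 1)) :* con (+ 1) in
              a :- (c :+ c) := con (+ 0) :- ((con (+ 1) :+ con (+ 1)) :+ a)) refl a))))

        negative : ¬ ∃ λ q → p * q ≈ 1#
        negative (q , pq≈1) = 0≤-resp (value q pq≈1) (nonneg _)
          (x-η<x 0# (0<+ (0<+ 0<1 (<⇒≤ 0<1)) (nonneg x)))

  open PositiveForm

  -- Stands for "`es` spans modulo null vectors", without coordinates; in this form the property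
  -- passes to a complement with one vector fewer.
  Separates : List V → PositiveForm → Set
  Separates es B = ∀ z → All (λ e → form B e z ≈ 0#) es → form B z z ≈ 0#

  -- The Schur complement B(x,y) - B(e,x) B(e,y) / B(e,e): the form B applied
  -- to the components of x and y orthogonal to e.
  module Complement (B : PositiveForm) (e : V) (b : Carrier) (β*b≈1 : form B e e * b ≈ 1#) where
    β : Carrier
    β = form B e e

    _⊥e : V → V
    x ⊥e = x ⊞ (- (b * form B e x)) · e

    form⊥ : V → V → Carrier
    form⊥ x y = form B x y - b * (form B e x * form B e y)

    abstract
      form⊥≈ : ∀ x y → form⊥ x y ≈ form B x (y ⊥e)
      form⊥≈ x y = sym (trans (linear B x y _ e) (trans (+-congˡ (*-congˡ (symmetric B x e)))
        (solve 4 (λ a b p q → a :+ (:- (b :* q)) :* p := a :- b :* (p :* q)) refl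
          (form B x y) b (form B e x) (form B e y))))

      e-⊥e : ∀ x → form B e (x ⊥e) ≈ 0#
      e-⊥e x = trans (linear B e x _ e) (trans
        (solve 3 (λ b β p → p :+ (:- (b :* p)) :* β := p :- β :* b :* p) refl b β (form B e x))
        (trans (+-congˡ (-‿cong (trans (*-congʳ β*b≈1) (*-identityˡ _)))) (-‿inverseʳ _)))

      form⊥-⊥e : ∀ x → form⊥ x x ≈ form B (x ⊥e) (x ⊥e)
      form⊥-⊥e x = trans (form⊥≈ x x) (sym (trans (linear B (x ⊥e) x _ e) (trans
        (+-cong (symmetric B _ _) (*-congˡ (trans (symmetric B _ _) (e-⊥e x))))
        (trans (+-congˡ (zeroʳ _)) (+-identityʳ _)))))

      form⊥-linear : ∀ x y t z → form⊥ x (y ⊞ t · z) ≈ form⊥ x y + t * form⊥ x z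
      form⊥-linear x y t z = trans (+-cong (linear B x y t z) (-‿cong (*-congˡ (*-congˡ (linear B e y t z)))))
        (solve 7 (λ a a′ t b p q q′ → (a :+ t :* a′) :- b :* (p :* (q :+ t :* q′))
             := (a :- b :* (p :* q)) :+ t :* (a′ :- b :* (p :* q′))) refl
          (form B x y) (form B x z) t b (form B e x) (form B e y) (form B e z))

      form≈ : ∀ x → form B x x ≈ form⊥ x x + b * (form B e x * form B e x)
      form≈ x = solve 2 (λ a c → a := (a :- c) :+ c) refl (form B x x) (b * (form B e x * form B e x))

    complement : PositiveForm
    complement = record
      { form      = form⊥
      ; symmetric = λ x y → +-cong (symmetric B x y) (-‿cong (*-congˡ (*-comm _ _)))
      ; linear    = form⊥-linear
      ; nonneg    = λ x → 0≤-resp (sym (form⊥-⊥e x)) (nonneg B (x ⊥e))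
      }

    abstract
      -- The hypothesis is applied to `z ⊥e`: it is orthogonal to `e` by construction, and to the
      -- rest of the list because `form⊥≈` moves the projection onto `z`.
      complement-separates : ∀ {es} → Separates (e ∷ es) B → Separates es complement
      complement-separates sep z orthogonal = trans (form⊥-⊥e z)
        (sep (z ⊥e) (e-⊥e z ∷ All.map (λ {x} → trans (sym (form⊥≈ x z))) orthogonal))

      module _ (0<b : 0# < b) (0≤β : 0# ≤ β) where
        complement-bounded : ∀ {x K} → form B x x ≤ K → form⊥ x x ≤ K
        complement-bounded {x} {K} xx≤K = ≤-trans (0≤-⇒≤ (0≤* (<⇒≤ 0<b) (0≤x² (form B e x)))
          (solve 2 (λ a c → c := a :- (a :- c)) refl (form B x x) (b * (form B e x * form B e x)))) xx≤K

        -- The Cauchy-Schwarz inequality for `e` and `x`, read off from nonnegativity of the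
        -- complement.
        coefficient-bounded : ∀ {x K} → form B x x ≤ K → form B e x * form B e x ≤ β * K
        coefficient-bounded {x} {K} xx≤K = 0≤-⇒≤
          (0≤* 0≤β (0≤+ (≤⇒0≤- xx≤K) (nonneg complement x)))
          (trans (solve 5 (λ a K β b p → β :* ((K :- a) :+ (a :- b :* (p :* p)))
                     := β :* K :- β :* b :* (p :* p)) refl
                   (form B x x) K β b (form B e x))
            (+-congˡ (-‿cong (trans (*-congʳ β*b≈1) (*-identityˡ _)))))

        -- By `form≈` the squared distance is the complement's squared distance plus `b` times the
        -- squared difference of coefficients. Since `β * b ≈ 1#`, each summand is at most `½ * ε`.
        close-from-complement : ∀ {x y ε} → dist² complement x y ≤ ½ * ε →
          (form B e x - form B e y) * (form B e x - form B e y) ≤ β * (½ * ε) → dist² B x y ≤ ε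
        close-from-complement {x} {y} {ε} close⊥ closeₑ = 0≤-⇒≤
          (0≤+ (≤⇒0≤- close⊥) (0≤* (<⇒≤ 0<b) (≤⇒0≤- closeₑ)))
          (trans (solve 5 (λ h d b β c → (h :- d) :+ b :* (β :* h :- c)
                     := (h :+ β :* b :* h) :- (d :+ b :* c)) refl
                   (½ * ε) (dist² complement x y) b β _)
            (+-cong (trans (+-congˡ (trans (*-congʳ β*b≈1) (*-identityˡ _))) (½+½ ε))
              (-‿cong (trans (+-congˡ (*-congˡ (*-cong difference difference))) (sym (form≈ _))))))
          where
          difference : form B e x - form B e y ≈ form B e (x ⊞ (- 1#) · y)
          difference = trans (solve 2 (λ p q → p :- q := p :+ (:- con (+ 1)) :* q) refl (form B e x) (form B e y))
            (sym (linear B e x (- 1#) y))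

  closePair : ∀ es B → Separates es B → (x : ℕ → V) → ∀ {K} → (∀ n → form B (x n) (x n) ≤ K) →
    ∀ {ε} → 0# < ε → ∃ λ i → ∃ λ j → i ℕ.< j × dist² B (x i) (x j) ≤ ε
  -- With nothing left to be orthogonal to, every vector is null, so any two indices serve.
  closePair [] B sep x bounded 0<ε =
    0 , 1 , ℕ.s≤s ℕ.z≤n , ≤-trans (≤-reflexive (sep _ [])) (<⇒≤ 0<ε)
  closePair (e ∷ es) B sep x {K} bounded {ε} 0<ε with ≤⇒<⊎≈ (nonneg B e)
  ... | inj₂ 0≈ee = closePair es B (λ z orth → sep z (nullVector B (sym 0≈ee) z ∷ orth)) x bounded 0<ε
  ... | inj₁ 0<β with positiveInverse 0<β
  ...   | b , 0<b , βb≈1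
    with clusteredSubsequence (λ n → form B e (x n))
           (λ n → Complement.coefficient-bounded B e b βb≈1 0<b (<⇒≤ 0<β) (bounded n))
           -- The factor `β` in the tolerance cancels the `b` by which the coefficient part of the
           -- distance is weighted.
           (*-pos 0<β (*-pos 0<½ 0<ε))
  ...     | σ , mono , closeₑ
    with closePair es (Complement.complement B e b βb≈1) (Complement.complement-separates B e b βb≈1 sep)
           (λ n → x (σ n)) (λ n → Complement.complement-bounded B e b βb≈1 0<b (<⇒≤ 0<β) (bounded (σ n)))
           (*-pos 0<½ 0<ε)
  ...       | i , j , i<j , close⊥ = σ i , σ j , mono i<j ,
              Complement.close-from-complement B e b βb≈1 0<b (<⇒≤ 0<β) close⊥ (closeₑ i j)

  -- Shift invariance of the Gram matrix: all that is kept of `y` being the orbit of an isometry.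
  Stationary : PositiveForm → (ℕ → V) → Set
  Stationary B y = ∀ m i j → form B (y (i ℕ.+ m)) (y (j ℕ.+ m)) ≈ form B (y i) (y j)

  -- Two close points of the sequence exist by `closePair`; stationarity removes their common shift,
  -- which brings the earlier one to `y 0`.
  recurrence : ∀ {es B} → Separates es B → ∀ {y} → Stationary B y →
    ∀ {ε} → 0# < ε → InfinitelyMany (λ k → dist² B (y 0) (y k) ≤ ε)
  recurrence {es} {B} sep {y} stationary {ε} 0<ε N
    -- Sampling at multiples of `suc N` makes the gap between two distinct samples exceed `N`.
    with closePair es B sep (λ n → y (n ℕ.* suc N))
           (λ n → ≤-reflexive (stationary (n ℕ.* suc N) 0 0)) 0<ε
  ... | i , j , i<j , close with ℕ.m≤n⇒∃[o]m+o≡n i<j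
  ...   | o , ≡.refl = suc o ℕ.* suc N , ℕ.m≤m+n (suc N) (o ℕ.* suc N) ,
    ≤-trans (≤-reflexive (dist²-cong B (shifted 0 0) (shifted 0 k) (shifted k k)))
            (≡.subst (λ n → dist² B (y iM) (y n) ≤ ε) (≡.sym position) close)
    where
    iM k : ℕ
    iM = i ℕ.* suc N
    k  = suc o ℕ.* suc N

    position : k ℕ.+ iM ≡ suc (i ℕ.+ o) ℕ.* suc N
    position = ≡.trans (≡.sym (ℕ.*-distribʳ-+ (suc N) (suc o) i)) (≡.cong (λ n → suc n ℕ.* suc N) (ℕ.+-comm o i))

    shifted : ∀ m n → form B (y m) (y n) ≈ form B (y (m ℕ.+ iM)) (y (n ℕ.+ iM))
    shifted m n = sym (stationary iM m n)

  module OrthonormalPair (B : PositiveForm) (a b : V)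
    (aa≈1 : form B a a ≈ 1#) (bb≈1 : form B b b ≈ 1#) (ba≈0 : form B b a ≈ 0#) where

    -- The squared length of the projection onto the real plane of `a` and `b`. For `a = ψ` and
    -- `b = J ψ` it is the squared modulus of the complex amplitude.
    weight : V → Carrier
    weight x = form B a x * form B a x + form B b x * form B b x

    abstract
      -- The difference of the two sides is `form B z z`, where `z` is what remains of `x` after
      -- projecting off `a` and then `b`.
      bessel : ∀ x → weight x ≤ form B x x
      bessel x = 0≤-⇒≤ (nonneg B z) (trans (expand B y (- q) b) (trans
        (+-cong (+-cong
          (trans (expand B x (- p) a) (+-cong (+-congˡ (*-congˡ (symmetric B x a))) (*-congˡ aa≈1)))
          (*-congˡ (trans (symmetric B y b) (trans (linear B b x (- p) a) (+-congˡ (*-congˡ ba≈0))))))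
          (*-congˡ bb≈1))
        (solve 3 (λ c p q → c :+ ((:- p) :+ (:- p)) :* p :+ (:- p) :* (:- p) :* con (+ 1)
                    :+ ((:- q) :+ (:- q)) :* (q :+ (:- p) :* con (+ 0)) :+ (:- q) :* (:- q) :* con (+ 1)
                    := c :- (p :* p :+ q :* q)) refl (form B x x) p q)))
        where
        p q : Carrier
        p = form B a x
        q = form B b x
        y z : V
        y = x ⊞ (- p) · a
        z = y ⊞ (- q) · b

      -- After multiplication by η, the difference of the two sides is a sum of
      -- squares and of products of the hypotheses.
      weight-perturbation : ∀ {s t η} → 0# < η → η ≤ 1# → form B t t ≤ 1# → dist² B s t ≤ η * η →
        weight s ≤ weight t + (η + η + η)
      weight-perturbation {s} {t} {η} 0<η η≤1 tt≤1 close = 0≤-⇒≤ (0≤-cancelˡ 0<η (0≤-resp identity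
        (0≤+ (0≤+ (0≤+ (0≤x² (η * p′ - (p - p′))) (0≤x² (η * q′ - (q - q′))))
                  (0≤* (0≤x² η) (≤⇒0≤- (≤-trans (bessel t) tt≤1))))
             (0≤+ (0≤* (0≤+ (<⇒≤ 0<1) (<⇒≤ 0<η)) (≤⇒0≤- weight-difference))
                  (0≤* (0≤x² η) (≤⇒0≤- η≤1)))))) refl
        where
        p p′ q q′ : Carrier
        p  = form B a s
        p′ = form B a t
        q  = form B b s
        q′ = form B b t

        difference : ∀ x → form B x (s ⊞ (- 1#) · t) ≈ form B x s - form B x t
        difference x = trans (linear B x s (- 1#) t)
          (solve 2 (λ p q → p :+ (:- con (+ 1)) :* q := p :- q) refl (form B x s) (form B x t))

        weight-difference : (p - p′) * (p - p′) + (q - q′) * (q - q′) ≤ η * η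
        weight-difference = ≤-trans
          (≤-reflexive (sym (+-cong (*-cong (difference a) (difference a))
                                    (*-cong (difference b) (difference b)))))
          (≤-trans (bessel _) close)

        identity : ((η * p′ - (p - p′)) * (η * p′ - (p - p′)) + (η * q′ - (q - q′)) * (η * q′ - (q - q′))
                     + η * η * (1# - (p′ * p′ + q′ * q′)))
                   + ((1# + η) * (η * η - ((p - p′) * (p - p′) + (q - q′) * (q - q′))) + η * η * (1# - η))
                   ≈ η * ((p′ * p′ + q′ * q′ + (η + η + η)) - (p * p + q * q))
        identity = solve 5 (λ η p p′ q q′ →
          ((η :* p′ :- (p :- p′)) :* (η :* p′ :- (p :- p′)) :+ (η :* q′ :- (q :- q′)) :* (η :* q′ :- (q :- q′))
                     :+ η :* η :* (con (+ 1) :- (p′ :* p′ :+ q′ :* q′)))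
                   :+ ((con (+ 1) :+ η) :* (η :* η :- ((p :- p′) :* (p :- p′) :+ (q :- q′) :* (q :- q′)))
                   :+ η :* η :* (con (+ 1) :- η))
                   := η :* ((p′ :* p′ :+ q′ :* q′ :+ (η :+ η :+ η)) :- (p :* p :+ q :* q))) refl η p p′ q q′

-- Prefixes of concatenated and periodic words.

module _ {A : Set} where

  prefix-⌢ : ∀ u (v : ωWord A) m → prefix (u ⌢ v) (length u ℕ.+ m) ≡ u ++ prefix v m
  prefix-⌢ []      v m = ≡.refl
  prefix-⌢ (a ∷ u) v m = ≡.cong (a ∷_) (prefix-⌢ u v m)

  prefix-cong : ∀ {v v′ : ωWord A} → (∀ n → v n ≡ v′ n) → ∀ m → prefix v m ≡ prefix v′ m
  prefix-cong v≗v′ zero    = ≡.refl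
  prefix-cong v≗v′ (suc m) = ≡.cong₂ _∷_ (v≗v′ 0) (prefix-cong (λ n → v≗v′ (suc n)) m)

  ⌢-lookup : ∀ u (v : ωWord A) i → (u ⌢ v) (toℕ i) ≡ lookup u i
  ⌢-lookup (a ∷ u) v Fin.zero    = ≡.refl
  ⌢-lookup (a ∷ u) v (Fin.suc i) = ⌢-lookup u v i

  ⌢-beyond : ∀ u (v : ωWord A) m → (u ⌢ v) (length u ℕ.+ m) ≡ v m
  ⌢-beyond []      v m = ≡.refl
  ⌢-beyond (a ∷ u) v m = ⌢-beyond u v m

  -- Turns the modular indexing of `_^ω` into the recursive equation on which the induction in
  -- `prefix-^ω` rests. The cases are a position inside the first copy of `w` and one beyond it.
  ^ω-unfold : ∀ (w : List⁺ A) n → (w ^ω) n ≡ (toList w ⌢ w ^ω) n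
  ^ω-unfold w n with n ℕ.<? List⁺.length w
  ... | yes n<l = ≡.sym (≡.trans (≡.cong (toList w ⌢ w ^ω) (≡.sym
          (≡.trans (Fin.toℕ-fromℕ< (m%n<n n (List⁺.length w))) (m<n⇒m%n≡m n<l))))
          (⌢-lookup (toList w) (w ^ω) (n mod List⁺.length w)))
  ... | no n≮l with ℕ.m≤n⇒∃[o]m+o≡n (ℕ.≮⇒≥ n≮l)
  ...   | m , ≡.refl = ≡.trans (≡.cong (lookup (toList w)) periodic) (≡.sym (⌢-beyond (toList w) (w ^ω) m))
    where
    l : ℕ
    l = List⁺.length w

    periodic : (l ℕ.+ m) mod l ≡ m mod l
    periodic = Fin.toℕ-injective (≡.trans (Fin.toℕ-fromℕ< (m%n<n (l ℕ.+ m) l)) (≡.trans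
      (≡.trans (≡.cong (_% l) (ℕ.+-comm l m)) ([m+n]%n≡m%n m l))
      (≡.sym (Fin.toℕ-fromℕ< (m%n<n m l)))))

  prefix-^ω : ∀ (w : List⁺ A) k → prefix (w ^ω) (k ℕ.* List⁺.length w) ≡ w ^ʷ k
  prefix-^ω w zero    = ≡.refl
  prefix-^ω w (suc k) = ≡.trans (prefix-cong (^ω-unfold w) (suc k ℕ.* List⁺.length w))
    (≡.trans (prefix-⌢ (toList w) (w ^ω) (k ℕ.* List⁺.length w)) (≡.cong (toList w ++_) (prefix-^ω w k)))

  ^ʷ-+ : ∀ (w : List⁺ A) i j → w ^ʷ (i ℕ.+ j) ≡ w ^ʷ i ++ w ^ʷ j
  ^ʷ-+ w zero    j = ≡.refl
  ^ʷ-+ w (suc i) j = ≡.trans (≡.cong (toList w ++_) (^ʷ-+ w i j))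
    (≡.sym (List.++-assoc (toList w) (w ^ʷ i) (w ^ʷ j)))

-- Suprema and infima of families of reals.

module Suprema (lem : ExcludedMiddle 0ℓ) (reals : CompleteOrderedField) where
  open CompleteOrderedField reals using (refl; sym; trans; IsLeastUpperBound)
  open Quantum lem reals
  open OrderedField reals
  open BoundedSequences lem reals
  open IntegerCoefficientSolver (CompleteOrderedField.commutativeRing reals)

  abstract
    ⨆-isLeastUpperBound : ∀ {I} (g : I → ℝ) → I → ∀ {b} → (∀ i → g i ≤ b) →
      IsLeastUpperBound (Range g) (⨆ g)
    ⨆-isLeastUpperBound g i {b} g≤b
      with lem {P = ∃ (Range g) × ∃ (CompleteOrderedField.UpperBound reals (Range g))}
    ... | yes (inhabited , bounded) = proj₂ (CompleteOrderedField.complete reals (Range g) inhabited bounded)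
    ... | no  neither = ⊥-elim (neither ((g i , i , refl) , b ,
            λ r (j , r≈gj) → ≤-trans (≤-reflexive r≈gj) (g≤b j)))

    ≤⨆ : ∀ {I} (g : I → ℝ) {b} → (∀ i → g i ≤ b) → ∀ i → g i ≤ ⨆ g
    ≤⨆ g g≤b i = proj₁ (⨆-isLeastUpperBound g i g≤b) (g i) (i , refl)

    ⨆≤ : ∀ {I} (g : I → ℝ) → I → ∀ {b} → (∀ i → g i ≤ b) → ⨆ g ≤ b
    ⨆≤ g i {b} g≤b = proj₂ (⨆-isLeastUpperBound g i g≤b) b
      λ r (j , r≈gj) → ≤-trans (≤-reflexive r≈gj) (g≤b j)

    <⨆⇒∃ : ∀ {I} (g : I → ℝ) {θ} → 0# ≤ θ → θ < ⨆ g → ∃ λ i → θ < g i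
    <⨆⇒∃ g {θ} 0≤θ θ<⨆ with lem {P = ∃ (Range g) × ∃ (CompleteOrderedField.UpperBound reals (Range g))}
    -- Here `⨆ g` is the default `0#`, which cannot exceed a nonnegative `θ`.
    ... | no  _ = ⊥-elim (0≤θ θ<⨆)
    ... | yes (inhabited , bounded) = ¬¬-elim λ none →
            proj₂ (proj₂ (CompleteOrderedField.complete reals (Range g) inhabited bounded)) θ
              (λ r (i , r≈gi) θ<r → none (i , <-≤-trans θ<r (≤-reflexive r≈gi))) θ<⨆

    -‿anti-≤ : ∀ {x y} → x ≤ y → - y ≤ - x
    -‿anti-≤ {x} {y} x≤y = 0≤-⇒≤ (≤⇒0≤- x≤y) (solve 2 (λ x y → y :- x := (:- x) :- (:- y)) refl x y)

    -‿swap-≤ : ∀ {x y} → - x ≤ y → - y ≤ x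
    -‿swap-≤ {x} {y} -x≤y = 0≤-⇒≤ (≤⇒0≤- -x≤y) (solve 2 (λ x y → y :- (:- x) := x :- (:- y)) refl x y)

    ⨅≤ : ∀ {I} (g : I → ℝ) {b} → (∀ i → b ≤ g i) → ∀ i → ⨅ g ≤ g i
    ⨅≤ g b≤g i = -‿swap-≤ (≤⨆ (λ i → - g i) (λ i → -‿anti-≤ (b≤g i)) i)

    ≤⨅ : ∀ {I} (g : I → ℝ) → I → ∀ {b} → (∀ i → b ≤ g i) → b ≤ ⨅ g
    ≤⨅ g i {b} b≤g = 0≤-⇒≤ (≤⇒0≤- (⨆≤ (λ i → - g i) i (λ i → -‿anti-≤ (b≤g i))))
      (solve 2 (λ b s → (:- b) :- s := (:- s) :- b) refl b (⨆ (λ i → - g i)))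

-- Runs of a quantum automaton and the two closure properties.

module Automaton (lem : ExcludedMiddle 0ℓ) (reals : CompleteOrderedField)
  {A : Set} (𝒜 : Quantum.QuantumAutomaton lem reals A) where
  open CompleteOrderedField reals
    using (refl; sym; trans; +-cong; +-congʳ; +-congˡ; *-cong; *-congˡ; -‿cong; *-pos; commutativeRing)
  open Quantum lem reals
  open QuantumAutomaton 𝒜
  open OrderedField reals
  open Suprema lem reals
  open IntegerCoefficientSolver commutativeRing

  _⊞_·_ : Carrierᴹ → ℝ → Carrierᴹ → Carrierᴹ
  x ⊞ t · z = x +ᴹ (t , 0#) *ₗ z

  open PositiveForms lem reals Carrierᴹ _⊞_·_

  -- Lets the real form see imaginary parts: `re ⟨ J x ∣ y ⟩` is `im ⟨ x ∣ y ⟩`.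
  J : Carrierᴹ → Carrierᴹ
  J x = (0# , 1#) *ₗ x

  abstract
    im-antisym : ∀ x y → im ⟨ x ∣ y ⟩ ≈ - im ⟨ y ∣ x ⟩
    im-antisym x y = proj₂ (⟨∣⟩-conj x y)

    re-Jʳ : ∀ x y → re ⟨ x ∣ J y ⟩ ≈ - im ⟨ x ∣ y ⟩
    re-Jʳ x y = trans (proj₁ (⟨∣⟩-* (0# , 1#) x y))
      (solve 2 (λ a b → con (+ 0) :* a :- con (+ 1) :* b := :- b) refl (re ⟨ x ∣ y ⟩) (im ⟨ x ∣ y ⟩))

    im-Jʳ : ∀ x y → im ⟨ x ∣ J y ⟩ ≈ re ⟨ x ∣ y ⟩
    im-Jʳ x y = trans (proj₂ (⟨∣⟩-* (0# , 1#) x y))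
      (solve 2 (λ a b → con (+ 0) :* b :+ con (+ 1) :* a := a) refl (re ⟨ x ∣ y ⟩) (im ⟨ x ∣ y ⟩))

    re-Jˡ : ∀ x y → re ⟨ J x ∣ y ⟩ ≈ im ⟨ x ∣ y ⟩
    re-Jˡ x y = trans (proj₁ (⟨∣⟩-conj (J x) y)) (trans (re-Jʳ y x) (sym (im-antisym x y)))

    re-linear : ∀ x y t z → re ⟨ x ∣ y ⊞ t · z ⟩ ≈ re ⟨ x ∣ y ⟩ + t * re ⟨ x ∣ z ⟩
    re-linear x y t z = trans (proj₁ (⟨∣⟩-+ x y _)) (+-congˡ (trans (proj₁ (⟨∣⟩-* (t , 0#) x z))
      (solve 3 (λ t a b → t :* a :- con (+ 0) :* b := t :* a) refl t (re ⟨ x ∣ z ⟩) (im ⟨ x ∣ z ⟩))))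

  realPart : PositiveForm
  realPart = record
    { form      = λ x y → re ⟨ x ∣ y ⟩
    ; symmetric = λ x y → proj₁ (⟨∣⟩-conj x y)
    ; linear    = re-linear
    ; nonneg    = ⟨∣⟩-nonneg
    }

  open PositiveForm realPart using (form; symmetric; dist²; dist²-cong)

  -- A complex spanning family spans over the reals only together with its multiples by the
  -- imaginary unit.
  spanning : List Carrierᴹ
  spanning = let d , e , _ = finiteDimensional in tabulate e ++ tabulate (λ i → J (e i))

  abstract
    form-sum : ∀ z {d} (e : Fin d → Carrierᴹ) (c : Fin d → ℂ) →
      (∀ i → form (e i) z ≈ 0#) → (∀ i → form (J (e i)) z ≈ 0#) →
      form z (sum +ᴹ-rawMonoid (λ i → c i *ₗ e i)) ≈ 0#
    form-sum z {zero}  e c ez≈0 Jez≈0 =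
      -- The empty sum `0ᴹ` is written as a zero multiple of itself so that homogeneity of the inner
      -- product applies.
      trans (proj₁ (⟨∣⟩-cong ≈ᴹ-refl (≈ᴹ-sym (*ₗ-zeroˡ 0ᴹ))))
      (trans (proj₁ (⟨∣⟩-* (0# , 0#) z 0ᴹ))
        (solve 2 (λ a b → con (+ 0) :* a :- con (+ 0) :* b := con (+ 0)) refl (re ⟨ z ∣ 0ᴹ ⟩) (im ⟨ z ∣ 0ᴹ ⟩)))
    form-sum z {suc d} e c ez≈0 Jez≈0 = trans (proj₁ (⟨∣⟩-+ z _ _)) (trans
      (+-cong (trans (proj₁ (⟨∣⟩-* (c Fin.zero) z (e Fin.zero)))
                (+-cong (*-congˡ (trans (symmetric z _) (ez≈0 Fin.zero)))
                        (-‿cong (*-congˡ (trans (im-antisym z _)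
                          (-‿cong (trans (sym (re-Jˡ _ z)) (Jez≈0 Fin.zero))))))))
              (form-sum z (λ i → e (Fin.suc i)) (λ i → c (Fin.suc i)) (λ i → ez≈0 (Fin.suc i))
                (λ i → Jez≈0 (Fin.suc i))))
      (solve 2 (λ a b → (a :* con (+ 0) :- b :* (:- con (+ 0))) :+ con (+ 0) := con (+ 0)) refl
        (re (c Fin.zero)) (im (c Fin.zero))))

    -- Expanding the second argument of `form z z` in the spanning family reduces the claim to
    -- `form-sum`.
    spanning-separates : Separates spanning realPart
    spanning-separates z orthogonal =
      let d , e , span = finiteDimensional
          c , z≈       = span z
          ez≈0 , Jez≈0 = All.++⁻ (tabulate e) orthogonal
      in trans (proj₁ (⟨∣⟩-cong ≈ᴹ-refl z≈)) (form-sum z e c (All.tabulate⁻ ez≈0) (All.tabulate⁻ Jez≈0))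

    U*-isometry : ∀ x s t → form (U* x s) (U* x t) ≈ form s t
    U*-isometry []      s t = refl
    U*-isometry (σ ∷ x) s t = trans (U*-isometry x _ _)
      (trans (proj₁ (adjoint s (op t))) (proj₁ (⟨∣⟩-cong ≈ᴹ-refl (adj-op t))))
      where open Unitary (U σ)

    U*-dist² : ∀ x s t → dist² (U* x s) (U* x t) ≈ dist² s t
    U*-dist² x s t = dist²-cong (U*-isometry x s s) (U*-isometry x s t) (U*-isometry x t t)

    U*-++ : ∀ x y s → U* (x ++ y) s ≡ U* y (U* x s)
    U*-++ x y s = List.foldl-++ (λ t σ → Unitary.op (U σ) t) s x y

    U*-unit : ∀ x → form (U* x s₀) (U* x s₀) ≈ 1#
    U*-unit x = trans (U*-isometry x s₀ s₀) (proj₁ s₀-isUnit)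

    run-⌢ : ∀ u v m → run (u ⌢ v) (length u ℕ.+ m) ≡ U* (prefix v m) (U* u s₀)
    run-⌢ u v m = ≡.trans (≡.cong (λ x → U* x s₀) (prefix-⌢ u v m)) (U*-++ u (prefix v m) s₀)

    -- The powers of one isometry applied to `s` form a stationary sequence.
    returns : ∀ w s {ε} → 0# < ε → InfinitelyMany (λ k → dist² s (U* (w ^ʷ k) s) ≤ ε)
    returns w s = recurrence {spanning} {realPart} spanning-separates {λ k → U* (w ^ʷ k) s} stationary
      where
      shift : ∀ i m → U* (w ^ʷ (i ℕ.+ m)) s ≡ U* (w ^ʷ m) (U* (w ^ʷ i) s)
      shift i m = ≡.trans (≡.cong (λ x → U* x s) (^ʷ-+ w i m)) (U*-++ (w ^ʷ i) (w ^ʷ m) s)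

      stationary : Stationary realPart (λ k → U* (w ^ʷ k) s)
      stationary m i j = ≡.subst₂ (λ x y → form x y ≈ form (U* (w ^ʷ i) s) (U* (w ^ʷ j) s))
        (≡.sym (shift i m)) (≡.sym (shift j m)) (U*-isometry (w ^ʷ m) _ _)

  module Amplitude (ψ : Carrierᴹ) (ψ-unit : IsUnit ψ) where

    abstract
      JJ≈1 : form (J ψ) (J ψ) ≈ 1#
      JJ≈1 = trans (re-Jˡ ψ (J ψ)) (trans (im-Jʳ ψ ψ) (proj₁ ψ-unit))

      Jψ≈0 : form (J ψ) ψ ≈ 0#
      Jψ≈0 = trans (re-Jˡ ψ ψ) (proj₂ ψ-unit)

    open OrthonormalPair realPart ψ (J ψ) (proj₁ ψ-unit) JJ≈1 Jψ≈0

    probability : Carrierᴹ → ℝ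
    probability s = ∣ ⟨ ψ ∣ s ⟩ ∣²

    abstract
      probability≈weight : ∀ s → probability s ≈ weight s
      probability≈weight s = +-congˡ (sym (*-cong (re-Jˡ ψ s) (re-Jˡ ψ s)))

      0≤probability : ∀ s → 0# ≤ probability s
      0≤probability s = 0≤+ (0≤x² _) (0≤x² _)

      probability≤1 : ∀ x → probability (U* x s₀) ≤ 1#
      probability≤1 x = ≤-trans (≤-reflexive (probability≈weight _)) (≤-trans (bessel _) (≤-reflexive (U*-unit x)))

      -- `δ′` and `ε` are fixed before `s` and `x`, so one choice serves infinitely many times of a
      -- run. A perturbation by `ε = η * η` costs at most `3η`.
      robust : ∀ {θ δ} → θ < δ → ∃ λ δ′ → θ < δ′ × ∃ λ ε → 0# < ε ×
        (∀ s x → dist² s (U* x s₀) ≤ ε → δ ≤ probability s → δ′ ≤ probability (U* x s₀))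
      -- With `η` at most a quarter of `δ - θ`, the level `δ - 3η` still exceeds `θ` by at least
      -- `η`.
      robust {θ} {δ} θ<δ with squareBelow (*-pos 0<½ (*-pos 0<½ (<⇒0<- θ<δ)))
      ... | η , 0<η , η≤1 , η≤¼ , _ = δ - (η + η + η) , θ<δ′ , η * η , *-pos 0<η 0<η ,
        λ s x close δ≤ → 0≤-⇒≤
          (0≤+ (≤⇒0≤- δ≤) (≤⇒0≤- (≤-trans (≤-reflexive (probability≈weight s))
            (≤-trans (weight-perturbation 0<η η≤1 (≤-reflexive (U*-unit x)) close)
              (≤-reflexive (+-congʳ (sym (probability≈weight (U* x s₀)))))))))
          (solve 4 (λ δ p q e → (p :- δ) :+ ((q :+ e) :- p) := q :- (δ :- e)) refl
            δ (probability s) (probability (U* x s₀)) (η + η + η))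
        where
        g : ℝ
        g = ½ * (½ * (δ - θ))

        θ<δ′ : θ < δ - (η + η + η)
        θ<δ′ = 0<-⇒< (0<+ 0<η (0≤+ (0≤+ (≤⇒0≤- η≤¼) (≤⇒0≤- η≤¼)) (0≤+ (≤⇒0≤- η≤¼) (≤⇒0≤- η≤¼))))
          (trans (solve 2 (λ η g → η :+ (((g :- η) :+ (g :- η)) :+ ((g :- η) :+ (g :- η)))
                                := ((g :+ g) :+ (g :+ g)) :- (η :+ η :+ η)) refl η g)
          (trans (+-congʳ (trans (+-cong (½+½ (½ * (δ - θ))) (½+½ (½ * (δ - θ)))) (½+½ (δ - θ))))
            (solve 3 (λ δ θ e → (δ :- θ) :- e := (δ :- e) :- θ) refl δ θ (η + η + η))))

  abstract
    ∈𝓛⇒often : ∀ {θ} → 0# ≤ θ → ∀ v → θ < fᴺᴰ 𝒜 v →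
      ∃ λ ((ψ , _) : UnitVectorOfF) → ∃ λ δ → θ < δ × InfinitelyMany (λ n → δ ≤ ∣ ⟨ ψ ∣ run v n ⟩ ∣²)
    ∈𝓛⇒often 0≤θ v θ<f with <⨆⇒∃ _ 0≤θ θ<f
    ... | Ψ@(ψ , _ , ψ-unit) , θ<g with <⨆⇒∃ _ 0≤θ θ<g
    -- The level `δ` is the infimum along `n` itself. The index is `suc N` because `mono` only gives
    -- `i ≤ n i`, and a time strictly beyond `N` is required.
    ...   | (n , mono) , θ<⨅ = Ψ , _ , θ<⨅ , λ N → n (suc N) , increasing⇒≥ mono (suc N) ,
              ⨅≤ (λ i → ∣ ⟨ ψ ∣ run v (n i) ⟩ ∣²) (λ i → 0≤probability _) (suc N)
      where open Amplitude ψ ψ-unit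

    -- Probabilities along a run lie between 0 and 1, so both suprema and the infimum are genuine
    -- and not default values.
    often⇒∈𝓛 : ∀ {θ δ} v ((ψ , _) : UnitVectorOfF) → θ < δ → InfinitelyMany (λ n → δ ≤ ∣ ⟨ ψ ∣ run v n ⟩ ∣²) →
      θ < fᴺᴰ 𝒜 v
    often⇒∈𝓛 {θ} {δ} v Ψ θ<δ often with subsequence often
    ... | σ , mono , above = <-≤-trans θ<δ (≤-trans (≤⨅ (value Ψ σ) 0 above)
            (≤-trans (≤⨆ (infimum Ψ) (infimum≤1 Ψ) (σ , mono))
                     (≤⨆ (λ Φ → ⨆ (infimum Φ)) (λ Φ → ⨆≤ (infimum Φ) (σ , mono) (infimum≤1 Φ)) Ψ)))
      where
      value : UnitVectorOfF → (ℕ → ℕ) → ℕ → ℝ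
      value (ψ , _) n i = ∣ ⟨ ψ ∣ run v (n i) ⟩ ∣²

      infimum : UnitVectorOfF → StrictlyIncreasing → ℝ
      infimum Ψ (n , _) = ⨅ (value Ψ n)

      infimum≤1 : ∀ Ψ σ → infimum Ψ σ ≤ 1#
      infimum≤1 Ψ@(ψ , _ , ψ-unit) (n , _) =
        ≤-trans (⨅≤ (value Ψ n) (λ i → Amplitude.0≤probability ψ ψ-unit _) 0)
                (Amplitude.probability≤1 ψ ψ-unit (prefix v (n 0)))

    pumping : ∀ {θ} → 0# ≤ θ → (w : List⁺ A) (u : List A) (v : ωWord A) → θ < fᴺᴰ 𝒜 (u ⌢ v) →
      InfinitelyMany (λ k → 0 ℕ.< k × θ < fᴺᴰ 𝒜 (u ⌢ ((w ^ʷ k) ⌢ v)))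
    pumping {θ} 0≤θ w u v uv∈𝓛 N with ∈𝓛⇒often 0≤θ (u ⌢ v) uv∈𝓛
    ... | Ψ@(ψ , _ , ψ-unit) , δ , θ<δ , often with Amplitude.robust ψ ψ-unit θ<δ
    ...   | δ′ , θ<δ′ , ε , 0<ε , stable with returns w (U* u s₀) 0<ε N
    ...     | k , N<k , close = k , N<k , ℕ.≤-<-trans ℕ.z≤n N<k , often⇒∈𝓛 _ Ψ θ<δ′ later
      where
      s : Carrierᴹ
      s = U* u s₀

      position : ℕ → ℕ
      position m = length u ℕ.+ (length (w ^ʷ k) ℕ.+ m)

      run-position : ∀ m → run (u ⌢ ((w ^ʷ k) ⌢ v)) (position m) ≡ U* (prefix v m) (U* (w ^ʷ k) s)
      run-position m = ≡.trans (run-⌢ u ((w ^ʷ k) ⌢ v) (length (w ^ʷ k) ℕ.+ m))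
        (≡.trans (≡.cong (λ x → U* x s) (prefix-⌢ (w ^ʷ k) v m)) (U*-++ (w ^ʷ k) (prefix v m) s))

      later : InfinitelyMany (λ n → δ′ ≤ ∣ ⟨ ψ ∣ run (u ⌢ ((w ^ʷ k) ⌢ v)) n ⟩ ∣²)
      -- A time beyond `length u + M` has the form `length u + m` with `M < m`; shifted past the
      -- inserted block it is still beyond `M`.
      later M with often (length u ℕ.+ M)
      ... | n , |u|+M<n , δ≤ with ℕ.m≤n⇒∃[o]m+o≡n (ℕ.≤-trans (ℕ.m≤m+n (length u) M) (ℕ.<⇒≤ |u|+M<n))
      ...   | m , ≡.refl = position m ,
              ℕ.<-≤-trans (ℕ.+-cancelˡ-< (length u) M m |u|+M<n)
                (ℕ.≤-trans (ℕ.m≤n+m m (length (w ^ʷ k))) (ℕ.m≤n+m _ (length u))) ,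
              stable (U* (prefix v m) s) (prefix (u ⌢ ((w ^ʷ k) ⌢ v)) (position m))
                -- Both states are moved by the same `prefix v m`, an isometry, so the single return
                -- after `w ^ʷ k` controls every later time.
                (≤-trans (≤-reflexive (≡.subst (λ t → dist² (U* (prefix v m) s) t ≈ dist² s (U* (w ^ʷ k) s))
                  (≡.sym (run-position m)) (U*-dist² (prefix v m) _ _))) close)
                (≡.subst (λ t → δ ≤ ∣ ⟨ ψ ∣ t ⟩ ∣²) (run-⌢ u v m) δ≤)

    periodicTail : ∀ {θ} → 0# ≤ θ → (v : ωWord A) → θ < fᴺᴰ 𝒜 v →
      InfinitelyMany (λ n → (w : List⁺ A) → θ < fᴺᴰ 𝒜 (prefix v n ⌢ (w ^ω)))
    periodicTail {θ} 0≤θ v v∈𝓛 N with ∈𝓛⇒often 0≤θ v v∈𝓛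
    -- `n` and `ε` are chosen from `v` alone, before `w` is given, so the same prefix serves every
    -- `w`.
    ... | Ψ@(ψ , _ , ψ-unit) , δ , θ<δ , often with Amplitude.robust ψ ψ-unit θ<δ | often N
    ...   | δ′ , θ<δ′ , ε , 0<ε , stable | n , N<n , δ≤ = n , N<n , λ w → often⇒∈𝓛 _ Ψ θ<δ′ (later w)
      where
      later : ∀ w → InfinitelyMany (λ m → δ′ ≤ ∣ ⟨ ψ ∣ run (prefix v n ⌢ (w ^ω)) m ⟩ ∣²)
      later w M with returns w (run v n) 0<ε M
      ... | k , M<k , close = position ,
              -- Since `w` is nonempty, `k` copies of it have length at least `k`.
              ℕ.<-≤-trans M<k (ℕ.≤-trans (ℕ.m≤m*n k (List⁺.length w)) (ℕ.m≤n+m _ (length (prefix v n)))) ,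
              stable (run v n) (prefix (prefix v n ⌢ (w ^ω)) position)
                (≡.subst (λ t → dist² (run v n) t ≤ ε) (≡.sym run-position) close) δ≤
        where
        position : ℕ
        position = length (prefix v n) ℕ.+ k ℕ.* List⁺.length w

        run-position : run (prefix v n ⌢ (w ^ω)) position ≡ U* (w ^ʷ k) (run v n)
        run-position = ≡.trans (run-⌢ (prefix v n) (w ^ω) (k ℕ.* List⁺.length w))
          (≡.cong (λ x → U* x (run v n)) (prefix-^ω w k))

theorem2 : (lem : ExcludedMiddle 0ℓ) (reals : CompleteOrderedField) →
    let open Quantum lem reals in
    {A : Set} → IsFinite A →
    (θ : ℝ) → 0# ≤ θ → θ < 1# →
    (L : Pred (ωWord A) 0ℓ) → (∃ λ (𝒜 : QuantumAutomaton A) → L ≐ 𝓛ᴺᴰ> θ 𝒜) →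
    ((w : List⁺ A) (u : List A) (v : ωWord A) → u ⌢ v ∈ L →
    InfinitelyMany (λ k → 0 ℕ.< k × u ⌢ ((w ^ʷ k) ⌢ v) ∈ L))
    ×
    ((v : ωWord A) → v ∈ L →
    InfinitelyMany (λ n → (w : List⁺ A) → prefix v n ⌢ (w ^ω) ∈ L))
theorem2 lem reals _ θ 0≤θ _ L (𝒜 , L⊆𝓛 , 𝓛⊆L) =
  (λ w u v uv∈L N → let k , N<k , 0<k , ∈𝓛 = pumping 0≤θ w u v (L⊆𝓛 uv∈L) N in k , N<k , 0<k , 𝓛⊆L ∈𝓛) ,
  (λ v v∈L N → let n , N<n , ∈𝓛 = periodicTail 0≤θ v (L⊆𝓛 v∈L) N in n , N<n , λ w → 𝓛⊆L (∈𝓛 w))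
  where open Automaton lem reals 𝒜
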